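{- Let $\Omega_1$ be the partial functional on subsets $X\subseteq\mathbb N^{\mathbb N}$ (given by characteristic functions) which is defined exactly when $X=\{x\}$ for some $x\in\mathbb N^{\mathbb N}$, and then $\Omega_1(X)=x$. Then $\Omega_1$ is not computable in any total countably based functional of type rank $3$.
   Context: Types: $0$ is a type of rank $0$; if $\sigma_1,\dots,\sigma_n$ ($n\ge 1$) are types, then $(\sigma_1,\dots,\sigma_n\to 0)$ is a type of rank $\max_i(\mathrm{rank}(\sigma_i)+1)$. Put $F(0)=\mathbb N$ and let $F(\sigma_1,\dots,\sigma_n\to 0)$ be the set of all total functions $F(\sigma_1)\times\cdots\times F(\sigma_n)\to\mathbb N$. Let $P(0)=\mathbb N\cup\{\bot\}$ and let $P(\sigma_1,\dots,\sigma_n\to 0)$ be the set of all functions $F(\sigma_1)\times\cdots\times F(\sigma_n)\to\mathbb N\cup\{\bot\}$, where $\bot$ means undefined (partial functionals, applied only to total arguments). A functional is total if it never takes the value $\bot$. Functionals with values in $\mathbb N^{\mathbb N}$ are viewed as $\mathbb N$-valued functionals with an extra number argument. Computability: Kleene's S1–S9, where partial functionals of type rank $\le 3$ are allowed as oracles. That is, $\{e\}(\vec\phi)\simeq a$ is the least relation closed under Kleene's schemes: successor, constants, projection to a number argument, composition, primitive recursion, permutation of arguments, application of an argument, and S9: $\{e\}(m,\vec\phi,\vec\psi)\simeq\{m\}(\vec\phi)$. An application $\phi_i(\lambda\vec\xi_1.\{d_1\}(\vec\xi_1,\vec\phi),\dots,\lambda\vec\xi_k.\{d_k\}(\vec\xi_k,\vec\phi))$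 has value $a\in\mathbb N$ iff all the displayed functionals are total (on total arguments) and $\phi_i$ applied to them equals $a$. A partial functional $\psi$ is computable in $\vec\phi$ if for some $e$, $\{e\}(\vec\xi,\vec\phi)\simeq\psi(\vec\xi)$ for all total $\vec\xi$ with $\psi(\vec\xi)\ne\bot$. Countably based (total case): let $\Phi\in F(\sigma)$ with $\mathrm{rank}(\sigma)\le 3$, $\sigma=(\tau_1,\dots,\tau_n\to 0)$, $\tau_i=(\delta_{i,1},\dots,\delta_{i,m_i}\to 0)$ with all $\delta_{i,j}$ of rank $\le 1$. $\Phi$ is countably based if for all $F_1,\dots,F_n$ there are countable sets $X_i\subseteq F(\delta_{i,1})\times\cdots\times F(\delta_{i,m_i})$ such that $\Phi(F_1,\dots,F_n)=\Phi(G_1,\dots,G_n)$ whenever $F_i$ and $G_i$ are equal on $X_i$ for each $i$. -}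

module Defs where

open import Axiom.ExcludedMiddle using (ExcludedMiddle)
open import Data.Fin.Base using (toℕ)
open import Data.List.Base using (List; []; _∷_)
open import Data.List.Membership.Propositional using (_∈_)
open import Data.List.NonEmpty.Base using (List⁺; _∷_; toList)
open import Data.List.Relation.Unary.All as All using (All; []; _∷_)
open import Data.List.Relation.Unary.All.Properties using (++⁺; take⁺; ─⁺)
import Data.List.Relation.Unary.Any as Any
open import Data.Maybe.Base using (Maybe; just; nothing)
open import Data.Nat.Base using (ℕ; suc; _*_; _^_; _⊔_)
open import Data.Product.Base using (Σ; ∃-syntax; _×_; _,_)
open import Data.Unit.Base using (⊤; tt)
open import Level using (0ℓ)
open import Relation.Binary.PropositionalEquality.Core using (_≡_)
open import Relation.Nullary using (¬_; yes; no)
open import Relation.Unary using (Pred)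

------------------------------------------------------------------------
-- Types and functionals

data Type : Set where
  𝟎   : Type
  _⇒𝟎 : List⁺ Type → Type

mutual
  rank : Type → ℕ
  rank 𝟎              = 0
  rank ((σ ∷ σs) ⇒𝟎) = suc (rank σ) ⊔ ranks σs

  ranks : List Type → ℕ
  ranks []       = 0
  ranks (σ ∷ σs) = suc (rank σ) ⊔ ranks σs

-- The argument types of a functional; a number takes no arguments.
dom : Type → List Type
dom 𝟎       = []
dom (σs ⇒𝟎) = toList σs

mutual
  F : Type → Set
  F 𝟎              = ℕ
  F ((σ ∷ σs) ⇒𝟎) = F σ × Args σs → ℕ

  Args : List Type → Set
  Args []       = ⊤
  Args (σ ∷ σs) = F σ × Args σs

-- nothing plays the role of ⊥.  Partial functionals have total arguments.
P : Type → Set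
P 𝟎       = Maybe ℕ
P (σs ⇒𝟎) = Args (toList σs) → Maybe ℕ

infixl 9 _·_ _·ᴾ_

_·_ : ∀ {σ} → F σ → Args (dom σ) → ℕ
_·_ {𝟎}              n _ = n
_·_ {(σ ∷ σs) ⇒𝟎} f ξ = f ξ

_·ᴾ_ : ∀ {σ} → P σ → Args (dom σ) → Maybe ℕ
_·ᴾ_ {𝟎}       n _ = n
_·ᴾ_ {σs ⇒𝟎} f ξ = f ξ

total : ∀ {σ} → F σ → P σ
total {𝟎}              n   = just n
total {(σ ∷ σs) ⇒𝟎} f ξ = just (f ξ)

Env : List Type → Set
Env = All P

totals : ∀ σs → Args σs → Env σs
totals []       _        = []
totals (σ ∷ σs) (f , fs) = total {σ} f ∷ totals σs fs

------------------------------------------------------------------------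
-- Indices

data Index : Set where
  S1 : Index
  S2 : (q : ℕ) → Index
  S3 : Index
  S4 : (d₁ d₂ : Index) → Index
  S5 : (d₁ d₂ : Index) → Index
  S6 : (k : ℕ) (d : Index) → Index
  S8 : (k : ℕ) (ds : List Index) → Index
  S9 : (k : ℕ) → Index

-- An injection of ℕ × ℕ into the positive numbers, so that ⟪_⟫ below is
-- injective on finite sequences.
⟨_,_⟩ : ℕ → ℕ → ℕ
⟨ a , b ⟩ = 2 ^ a * suc (2 * b)

⟪_⟫ : List ℕ → ℕ
⟪ [] ⟫     = 0
⟪ n ∷ ns ⟫ = ⟨ n , ⟪ ns ⟫ ⟩

mutual
  ⌜_⌝ : Index → ℕ
  ⌜ S1 ⌝       = ⟪ 1 ∷ [] ⟫
  ⌜ S2 q ⌝     = ⟪ 2 ∷ q ∷ [] ⟫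
  ⌜ S3 ⌝       = ⟪ 3 ∷ [] ⟫
  ⌜ S4 d₁ d₂ ⌝ = ⟪ 4 ∷ ⌜ d₁ ⌝ ∷ ⌜ d₂ ⌝ ∷ [] ⟫
  ⌜ S5 d₁ d₂ ⌝ = ⟪ 5 ∷ ⌜ d₁ ⌝ ∷ ⌜ d₂ ⌝ ∷ [] ⟫
  ⌜ S6 k d ⌝   = ⟪ 6 ∷ k ∷ ⌜ d ⌝ ∷ [] ⟫
  ⌜ S8 k ds ⌝  = ⟪ 8 ∷ k ∷ ⌜ ds ⌝* ∷ [] ⟫
  ⌜ S9 k ⌝     = ⟪ 9 ∷ k ∷ [] ⟫

  ⌜_⌝* : List Index → ℕ
  ⌜ [] ⌝*     = 0
  ⌜ d ∷ ds ⌝* = ⟨ ⌜ d ⌝ , ⌜ ds ⌝* ⟩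

------------------------------------------------------------------------
-- Kleene computations

-- In the application scheme (s8), ds ⟦ φ ⟧≃* Gs says that for each j the
-- functional λξ.{d_j}(ξ,φ) is total and equal to G_j; this subsumes the
-- scheme usually called S7, where the argument is a number.
-- As in Kleene's formulation of the permutation scheme (s6), the argument
-- in position k (counted from 0) is moved to the front; iteration yields
-- every permutation.
-- In (s9), {e}(m,φ,ψ) ≃ {m}(φ) with φ the first k arguments after m, and
-- the number m is read as the Gödel number of an index.

infix 4 _⟦_⟧≃_ _⟦_⟧≃*_

mutual
  data _⟦_⟧≃_ : Index → ∀ {Γ} → Env Γ → ℕ → Set where
    s1  : ∀ {Γ m} {φ : Env Γ} →
          S1 ⟦ _∷_ {x = 𝟎} (just m) φ ⟧≃ suc m
    s2  : ∀ {Γ q} {φ : Env Γ} →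
          S2 q ⟦ φ ⟧≃ q
    s3  : ∀ {Γ m} {φ : Env Γ} →
          S3 ⟦ _∷_ {x = 𝟎} (just m) φ ⟧≃ m
    s4  : ∀ {Γ d₁ d₂ b a} {φ : Env Γ} →
          d₂ ⟦ φ ⟧≃ b →
          d₁ ⟦ _∷_ {x = 𝟎} (just b) φ ⟧≃ a →
          S4 d₁ d₂ ⟦ φ ⟧≃ a
    s5₀ : ∀ {Γ d₁ d₂ a} {φ : Env Γ} →
          d₁ ⟦ φ ⟧≃ a →
          S5 d₁ d₂ ⟦ _∷_ {x = 𝟎} (just 0) φ ⟧≃ a
    s5₊ : ∀ {Γ d₁ d₂ n b a} {φ : Env Γ} →
          S5 d₁ d₂ ⟦ _∷_ {x = 𝟎} (just n) φ ⟧≃ b →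
          d₂ ⟦ _∷_ {x = 𝟎} (just n) (_∷_ {x = 𝟎} (just b) φ) ⟧≃ a →
          S5 d₁ d₂ ⟦ _∷_ {x = 𝟎} (just (suc n)) φ ⟧≃ a
    s6  : ∀ {Γ σ k d a} {φ : Env Γ} (i : σ ∈ Γ) →
          toℕ (Any.index i) ≡ k →
          d ⟦ All.lookup φ i ∷ ─⁺ i φ ⟧≃ a →
          S6 k d ⟦ φ ⟧≃ a
    s8  : ∀ {Γ σs k ds a} {φ : Env Γ} (i : (σs ⇒𝟎) ∈ Γ) →
          toℕ (Any.index i) ≡ k →
          (Gs : Args (toList σs)) →
          _⟦_⟧≃*_ ds {σs = toList σs} φ Gs →
          All.lookup φ i Gs ≡ just a →
          S8 k ds ⟦ φ ⟧≃ a
    s9  : ∀ {Γ k m d a} {φ : Env Γ} →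
          ⌜ d ⌝ ≡ m →
          d ⟦ take⁺ k φ ⟧≃ a →
          S9 k ⟦ _∷_ {x = 𝟎} (just m) φ ⟧≃ a

  data _⟦_⟧≃*_ : List Index → ∀ {Γ σs} → Env Γ → Args σs → Set where
    []  : ∀ {Γ} {φ : Env Γ} →
          _⟦_⟧≃*_ [] {σs = []} φ tt
    _∷_ : ∀ {Γ σ σs d ds} {φ : Env Γ} {G : F σ} {Gs : Args σs} →
          (∀ ξ → d ⟦ ++⁺ (totals (dom σ) ξ) φ ⟧≃ (_·_ {σ} G ξ)) →
          _⟦_⟧≃*_ ds {σs = σs} φ Gs →
          _⟦_⟧≃*_ (d ∷ ds) {σs = σ ∷ σs} φ (G , Gs)

infix 4 ｛_｝_≃_

｛_｝_≃_ : ℕ → ∀ {Γ} → Env Γ → ℕ → Set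
｛ e ｝ φ ≃ a = ∃[ d ] ⌜ d ⌝ ≡ e × d ⟦ φ ⟧≃ a

Computable : ∀ σ → P σ → ∀ {Γ} → Env Γ → Set
Computable σ ψ φ =
  ∃[ e ] ∀ (ξ : Args (dom σ)) a →
    _·ᴾ_ {σ} ψ ξ ≡ just a → ｛ e ｝ ++⁺ (totals (dom σ) ξ) φ ≃ a

------------------------------------------------------------------------
-- Countably based functionals

-- Countable means finite (possibly empty) or countably infinite: the
-- elements of X all occur in one partial enumeration.
Countable : ∀ {A : Set} → Pred A 0ℓ → Set
Countable {A} X =
  Σ (ℕ → Maybe A) λ e → ∀ x → X x → ∃[ n ] e n ≡ just x

CountableSubset : Set → Set₁
CountableSubset A = Σ (Pred A 0ℓ) Countable

Bases : List Type → Set₁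
Bases = All (λ τ → CountableSubset (Args (dom τ)))

EqualOn : ∀ {τs} → Bases τs → Args τs → Args τs → Set
EqualOn {[]}    []             _        _        = ⊤
EqualOn {τ ∷ _} ((X , _) ∷ Xs) (f , fs) (g , gs) =
  (∀ ξ → X ξ → _·_ {τ} f ξ ≡ _·_ {τ} g ξ) × EqualOn Xs fs gs

CountablyBased : ∀ σ → F σ → Set₁
CountablyBased σ Φ =
  ∀ (fs : Args (dom σ)) → Σ (Bases (dom σ)) λ Xs → ∀ (gs : Args (dom σ)) →
    EqualOn Xs fs gs → _·_ {σ} Φ fs ≡ _·_ {σ} Φ gs

------------------------------------------------------------------------
-- The functional Ω₁

𝟏 𝟐 τΩ₁ : Type
𝟏   = (𝟎 ∷ []) ⇒𝟎
𝟐   = (𝟏 ∷ []) ⇒𝟎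
τΩ₁ = (𝟐 ∷ 𝟎 ∷ []) ⇒𝟎

_IsCharacteristicFunctionOf_ : F 𝟐 → Pred (F 𝟏) 0ℓ → Set
f IsCharacteristicFunctionOf X =
  ∀ y → (X y → f (y , tt) ≡ 1) × (¬ X y → f (y , tt) ≡ 0)

-- The value Ω₁(X) ∈ ℕ^ℕ is read off through an additional number argument.
Ω₁ : ExcludedMiddle 0ℓ → P τΩ₁
Ω₁ em (X , n , _) with em {∃[ x ] X IsCharacteristicFunctionOf (_≡ x)}
... | yes (x , _) = just (x (n , tt))
... | no  _       = nothing

{-# OPTIONS --safe #-}
module Submission where

-- Run a computation in Φ and a type-2 functional f, and compare it with the
-- same computation for a fixed f₀.  Its support relative to f₀ is the set of
-- points at which f₀ is queried in the subcomputations that matter: at an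
-- application these are the ones in the countable bases and, if some argument
-- is not total, one point of divergence.  The support is countable, since
-- each computation has countably many such subcomputations and paths are
-- finite.  If f agrees with f₀ on the support and the computation converges
-- for f, then it converges for f₀, to the same value.  With f₀ = ∅, an index
-- for Ω₁ would yield the same value x(0) for all singletons {x} with x
-- outside a countable set.

open import Defs
open import Axiom.ExcludedMiddle using (ExcludedMiddle)
open import Axiom.Extensionality.Propositional using (Extensionality)
open import Data.Empty using (⊥-elim)
open import Data.Fin.Base using (toℕ)
open import Data.List.Base using (List; []; _∷_)
open import Data.List.Membership.Propositional using (_∈_)
open import Data.List.NonEmpty.Base using (_∷_; toList)
open import Data.List.Properties using (∷-injective)
open import Data.List.Relation.Unary.All as All using (All; []; _∷_)
open import Data.List.Relation.Unary.All.Properties using (++⁺; take⁺; ─⁺; lookup-map)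
open import Data.List.Relation.Unary.Any as Any using (here; there)
open import Data.Maybe.Base using (Maybe; just; nothing; map; _>>=_)
open import Data.Maybe.Properties using (just-injective)
open import Data.Nat.Base using (ℕ; zero; suc; _*_; _^_; _≤_; z≤n; s≤s; s≤s⁻¹)
open import Data.Nat.Properties
  using (even≢odd; *-assoc; *-identityˡ; *-cancelˡ-≡; suc-injective; 1+n≢n; ≤-reflexive;
         m≤n⇒m≤1+n; m⊔n≤o⇒m≤o; m⊔n≤o⇒n≤o)
open import Data.Product.Base using (Σ-syntax; ∃-syntax; _×_; _,_; proj₁; proj₂)
open import Data.Unit.Base using (⊤; tt)
open import Function.Base using (_∘_)
open import Level using (0ℓ)
open import Relation.Binary.PropositionalEquality
  using (_≡_; _≢_; refl; sym; trans; cong; cong₂; subst)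
open import Relation.Nullary using (¬_; yes; no; contradiction)
open import Relation.Nullary.Decidable using (decidable-stable)

-- Injectivity of the coding

-- Cancel factors of two until an exponent is `zero`; were the other exponent positive, an odd
-- number would be even.
⟨,⟩-injective : ∀ a {b} c {d} → ⟨ a , b ⟩ ≡ ⟨ c , d ⟩ → a ≡ c × b ≡ d
⟨,⟩-injective zero {b} zero {d} eq = refl , *-cancelˡ-≡ b d 2 (suc-injective
  (trans (sym (*-identityˡ _)) (trans eq (*-identityˡ _))))
⟨,⟩-injective zero {b} (suc c) {d} eq = contradiction
  (trans (sym (*-assoc 2 (2 ^ c) _)) (trans (sym eq) (*-identityˡ _)))
  (even≢odd ⟨ c , d ⟩ b)
⟨,⟩-injective (suc a) {b} zero {d} eq = contradiction
  (trans (sym (*-assoc 2 (2 ^ a) _)) (trans eq (*-identityˡ _)))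
  (even≢odd ⟨ a , b ⟩ d)
⟨,⟩-injective (suc a) {b} (suc c) {d} eq
  with refl , eq′ ← ⟨,⟩-injective a c (*-cancelˡ-≡ ⟨ a , b ⟩ ⟨ c , d ⟩ 2
    (trans (sym (*-assoc 2 (2 ^ a) _)) (trans eq (*-assoc 2 (2 ^ c) _)))) = refl , eq′

⟨,⟩≢0 : ∀ a b → ⟨ a , b ⟩ ≢ 0
⟨,⟩≢0 zero    b ()
⟨,⟩≢0 (suc a) b eq = go ⟨ a , b ⟩ (⟨,⟩≢0 a b) (trans (sym (*-assoc 2 (2 ^ a) _)) eq)
  where
  go : ∀ n → n ≢ 0 → 2 * n ≢ 0
  go zero    n≢0 _ = n≢0 refl
  go (suc n) _ ()

⟪⟫-injective : ∀ ms ns → ⟪ ms ⟫ ≡ ⟪ ns ⟫ → ms ≡ ns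
⟪⟫-injective []       []       _  = refl
⟪⟫-injective []       (n ∷ ns) eq = contradiction (sym eq) (⟨,⟩≢0 n ⟪ ns ⟫)
⟪⟫-injective (m ∷ ms) []       eq = contradiction eq (⟨,⟩≢0 m ⟪ ms ⟫)
⟪⟫-injective (m ∷ ms) (n ∷ ns) eq
  with refl , eq′ ← ⟨,⟩-injective m n eq = cong (m ∷_) (⟪⟫-injective ms ns eq′)

-- The sequence before coding: after `⟪⟫-injective`, the leading tags separate the schemes.
fields : Index → List ℕ
fields S1         = 1 ∷ []
fields (S2 q)     = 2 ∷ q ∷ []
fields S3         = 3 ∷ []
fields (S4 d₁ d₂) = 4 ∷ ⌜ d₁ ⌝ ∷ ⌜ d₂ ⌝ ∷ []
fields (S5 d₁ d₂) = 5 ∷ ⌜ d₁ ⌝ ∷ ⌜ d₂ ⌝ ∷ []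
fields (S6 k d)   = 6 ∷ k ∷ ⌜ d ⌝ ∷ []
fields (S8 k ds)  = 8 ∷ k ∷ ⌜ ds ⌝* ∷ []
fields (S9 k)     = 9 ∷ k ∷ []

⌜⌝-fields : ∀ d → ⌜ d ⌝ ≡ ⟪ fields d ⟫
⌜⌝-fields S1       = refl
⌜⌝-fields (S2 _)   = refl
⌜⌝-fields S3       = refl
⌜⌝-fields (S4 _ _) = refl
⌜⌝-fields (S5 _ _) = refl
⌜⌝-fields (S6 _ _) = refl
⌜⌝-fields (S8 _ _) = refl
⌜⌝-fields (S9 _)   = refl

∷₃-injective : ∀ {t a b c d : ℕ} → _≡_ {A = List ℕ} (t ∷ a ∷ b ∷ []) (t ∷ c ∷ d ∷ []) → a ≡ c × b ≡ d
∷₃-injective refl = refl , refl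

mutual
  fields-injective : ∀ d d′ → fields d ≡ fields d′ → d ≡ d′
  fields-injective S1         S1           refl = refl
  fields-injective (S2 _)     (S2 _)       refl = refl
  fields-injective S3         S3           refl = refl
  fields-injective (S4 d₁ d₂) (S4 d₁′ d₂′) eq with eq₁ , eq₂ ← ∷₃-injective eq =
    cong₂ S4 (⌜⌝-injective d₁ d₁′ eq₁) (⌜⌝-injective d₂ d₂′ eq₂)
  fields-injective (S5 d₁ d₂) (S5 d₁′ d₂′) eq with eq₁ , eq₂ ← ∷₃-injective eq =
    cong₂ S5 (⌜⌝-injective d₁ d₁′ eq₁) (⌜⌝-injective d₂ d₂′ eq₂)
  fields-injective (S6 _ d)   (S6 _ d′)    eq with eq₁ , eq₂ ← ∷₃-injective eq =
    cong₂ S6 eq₁ (⌜⌝-injective d d′ eq₂)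
  fields-injective (S8 _ ds)  (S8 _ ds′)   eq with eq₁ , eq₂ ← ∷₃-injective eq =
    cong₂ S8 eq₁ (⌜⌝*-injective ds ds′ eq₂)
  fields-injective (S9 _)     (S9 _)       refl = refl

  ⌜⌝-injective : ∀ d d′ → ⌜ d ⌝ ≡ ⌜ d′ ⌝ → d ≡ d′
  ⌜⌝-injective d d′ eq = fields-injective d d′ (⟪⟫-injective (fields d) (fields d′)
    (trans (sym (⌜⌝-fields d)) (trans eq (⌜⌝-fields d′))))

  ⌜⌝*-injective : ∀ ds ds′ → ⌜ ds ⌝* ≡ ⌜ ds′ ⌝* → ds ≡ ds′
  ⌜⌝*-injective []       []         _  = refl
  ⌜⌝*-injective []       (d ∷ ds)   eq = contradiction (sym eq) (⟨,⟩≢0 ⌜ d ⌝ ⌜ ds ⌝*)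
  ⌜⌝*-injective (d ∷ ds) []         eq = contradiction eq (⟨,⟩≢0 ⌜ d ⌝ ⌜ ds ⌝*)
  ⌜⌝*-injective (d ∷ ds) (d′ ∷ ds′) eq with eq₁ , eq₂ ← ⟨,⟩-injective ⌜ d ⌝ ⌜ d′ ⌝ eq =
    cong₂ _∷_ (⌜⌝-injective d d′ eq₁) (⌜⌝*-injective ds ds′ eq₂)

-- Determinism of computations

Position : List Type → Set
Position Γ = Σ[ σ ∈ Type ] σ ∈ Γ

locate : ∀ Γ → ℕ → Maybe (Position Γ)
locate []      _       = nothing
locate (σ ∷ Γ) zero    = just (σ , here refl)
locate (σ ∷ Γ) (suc k) = map (λ (τ , i) → τ , there i) (locate Γ k)

locate-index : ∀ {Γ σ} (i : σ ∈ Γ) → locate Γ (toℕ (Any.index i)) ≡ just (σ , i)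
locate-index (here refl) = refl
locate-index (there i) rewrite locate-index i = refl

-- `locate Γ` inverts the index and recovers the type along with the position.
index-injective : ∀ {Γ σ τ k} (i : σ ∈ Γ) (j : τ ∈ Γ) →
  toℕ (Any.index i) ≡ k → toℕ (Any.index j) ≡ k →
  _≡_ {A = Position Γ} (σ , i) (τ , j)
index-injective {Γ} i j refl eq =
  just-injective (trans (sym (locate-index i)) (trans (cong (locate Γ) (sym eq)) (locate-index j)))

·-extensional : Extensionality 0ℓ 0ℓ → ∀ {σ} (f g : F σ) →
  (∀ ξ → _·_ {σ} f ξ ≡ _·_ {σ} g ξ) → f ≡ g
·-extensional ext {𝟎}            f g eq = eq tt
·-extensional ext {(_ ∷ _) ⇒𝟎} f g eq = ext eq

module _ (ext : Extensionality 0ℓ 0ℓ) where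

  mutual
    -- In S9 the Gödel number fixes the index. In S8 the arguments are determined pointwise, and
    -- extensionality makes the tuples equal.
    deterministic : ∀ {Γ d a b} {φ : Env Γ} → d ⟦ φ ⟧≃ a → d ⟦ φ ⟧≃ b → a ≡ b
    deterministic s1 s1 = refl
    deterministic s2 s2 = refl
    deterministic s3 s3 = refl
    deterministic (s4 p q) (s4 p′ q′) with refl ← deterministic p p′ = deterministic q q′
    deterministic (s5₀ p) (s5₀ p′) = deterministic p p′
    deterministic (s5₊ p q) (s5₊ p′ q′) with refl ← deterministic p p′ = deterministic q q′
    deterministic (s6 i eq p) (s6 i′ eq′ p′)
      with refl ← index-injective i i′ eq eq′ = deterministic p p′
    deterministic (s8 i eq Gs ps v) (s8 i′ eq′ Gs′ ps′ v′)
      with refl ← index-injective i i′ eq eq′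
      with refl ← deterministic* ps ps′ = just-injective (trans (sym v) v′)
    deterministic (s9 {d = d} eq p) (s9 {d = d′} eq′ p′)
      with refl ← ⌜⌝-injective d d′ (trans eq (sym eq′)) = deterministic p p′

    deterministic* : ∀ {Γ ds σs} {φ : Env Γ} {Gs Gs′ : Args σs} →
      ds ⟦ φ ⟧≃* Gs → ds ⟦ φ ⟧≃* Gs′ → Gs ≡ Gs′
    deterministic* [] [] = refl
    deterministic* (_∷_ {σ = σ} {G = G} p ps) (_∷_ {G = G′} p′ ps′) =
      cong₂ _,_ (·-extensional ext {σ} G G′ (λ ξ → deterministic (p ξ) (p′ ξ)))
                (deterministic* ps ps′)

-- Functionals of low rank

RankAtMost : ℕ → Type → Set
RankAtMost n σ = rank σ ≤ n

ranks-dom : ∀ σs {n} → ranks σs ≤ suc n → All (RankAtMost n) σs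
ranks-dom []       _ = []
ranks-dom (σ ∷ σs) h =
  s≤s⁻¹ (m⊔n≤o⇒m≤o (suc (rank σ)) (ranks σs) h) ∷
  ranks-dom σs (m⊔n≤o⇒n≤o (suc (rank σ)) (ranks σs) h)

rank-dom : ∀ σ {n} → rank σ ≤ suc n → All (RankAtMost n) (dom σ)
rank-dom 𝟎               _ = []
rank-dom ((σ ∷ σs) ⇒𝟎) h = ranks-dom (σ ∷ σs) h

rank≰0 : ∀ σs → ¬ rank (σs ⇒𝟎) ≤ 0
rank≰0 (σ ∷ σs) h with () ← m⊔n≤o⇒m≤o (suc (rank σ)) (ranks σs) h

AllOf : (A : Set) → A → Set
AllOf A _ = ⊤

fullBases : ∀ {τs} → All (λ τ → Countable (AllOf (Args (dom τ)))) τs → Bases τs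
fullBases = All.map (AllOf _ ,_)

countable-dom-𝟎 : ∀ {τ} → RankAtMost 0 τ → Countable (AllOf (Args (dom τ)))
countable-dom-𝟎 {𝟎}      _ = (λ _ → just tt) , λ _ _ → 0 , refl
countable-dom-𝟎 {σs ⇒𝟎} h = ⊥-elim (rank≰0 σs h)

countable-dom-𝟏 : Countable (AllOf (Args (dom 𝟏)))
countable-dom-𝟏 = (λ n → just (n , tt)) , λ (n , _) _ → n , refl

module _ (ext : Extensionality 0ℓ 0ℓ) where

  equalOn-full : ∀ {τs} (cs : All (λ τ → Countable (AllOf (Args (dom τ)))) τs) {fs gs : Args τs} →
    EqualOn (fullBases cs) fs gs → fs ≡ gs
  equalOn-full []                 _          = refl
  equalOn-full {τ ∷ _} (_ ∷ cs) {f , _} {g , _} (eq , eqs) =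
    cong₂ _,_ (·-extensional ext {τ} f g (λ ξ → eq ξ tt)) (equalOn-full cs eqs)

  -- Arguments, if any, are numbers with a one-point domain. Hence the inputs `ξ` of argument
  -- functionals may join the environment as constants.
  rank≤1⇒countablyBased : ∀ σ → rank σ ≤ 1 → (f : F σ) → CountablyBased σ f
  rank≤1⇒countablyBased σ h f _ =
    fullBases cs , λ _ eq → cong (_·_ {σ} f) (equalOn-full cs eq)
    where
    cs : All (λ τ → Countable (AllOf (Args (dom τ)))) (dom σ)
    cs = All.map countable-dom-𝟎 (rank-dom σ h)

-- Environments with a hole for one functional of type 𝟐

-- Rank at most 3 leaves rank at most 1 for the inputs of the arguments in an application. With
-- `hole` marking the varied functional, one list of entries describes the environments for both `f`
-- and `f₀`.
data Entry : Type → Set₁ where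
  const : ∀ {σ} (f : F σ) → rank σ ≤ 3 → CountablyBased σ f → Entry σ
  hole  : Entry 𝟐

Entries : List Type → Set₁
Entries = All Entry

fill : F 𝟐 → ∀ {σ} → Entry σ → F σ
fill _ (const g _ _) = g
fill f hole          = f

rank-entry : ∀ {σ} → Entry σ → rank σ ≤ 3
rank-entry (const _ h _) = h
rank-entry hole          = s≤s (s≤s z≤n)

env : F 𝟐 → ∀ {Γ} → Entries Γ → Env Γ
env f = All.map (λ {σ} e → total {σ} (fill f e))

env-lookup : ∀ f {Γ σ} (es : Entries Γ) (i : σ ∈ Γ) →
  All.lookup (env f es) i ≡ total {σ} (fill f (All.lookup es i))
env-lookup f es i = lookup-map es i

env-─ : ∀ f {Γ σ} (es : Entries Γ) (i : σ ∈ Γ) → ─⁺ i (env f es) ≡ env f (─⁺ i es)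
env-─ f (_ ∷ _)  (here _)  = refl
env-─ f (_ ∷ es) (there i) = cong (_ ∷_) (env-─ f es i)

env-take : ∀ f {Γ} k (es : Entries Γ) → take⁺ k (env f es) ≡ env f (take⁺ k es)
env-take f zero    _        = refl
env-take f (suc k) []       = refl
env-take f (suc k) (_ ∷ es) = cong (_ ∷_) (env-take f k es)

-- The hereditary support of a computation

module Support (em : ExcludedMiddle 0ℓ) (ext : Extensionality 0ℓ 0ℓ) (f₀ : F 𝟐) where

  constants : ∀ {δs} → All (RankAtMost 1) δs → Args δs → Entries δs
  constants []       _        = []
  constants (h ∷ hs) (f , fs) =
    const f (m≤n⇒m≤1+n (m≤n⇒m≤1+n h)) (rank≤1⇒countablyBased ext _ h f) ∷ constants hs fs

  push : ∀ {Γ τ} → rank τ ≤ 2 → Args (dom τ) → Entries Γ → Entries _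
  push {τ = τ} h ξ es = ++⁺ (constants (rank-dom τ h) ξ) es

  env-push : ∀ f {Γ τ} (h : rank τ ≤ 2) ξ (es : Entries Γ) →
    env f (push {τ = τ} h ξ es) ≡ ++⁺ (totals (dom τ) ξ) (env f es)
  env-push f {τ = τ} h ξ es = go (rank-dom τ h) ξ
    where
    go : ∀ {δs} (hs : All (RankAtMost 1) δs) (ξ : Args δs) →
      env f (++⁺ (constants hs ξ) es) ≡ ++⁺ (totals δs ξ) (env f es)
    go []       _       = refl
    go (_ ∷ hs) (_ , ξ) = cong (_ ∷_) (go hs ξ)

  num : ℕ → Entry 𝟎
  num n = const n z≤n (rank≤1⇒countablyBased ext 𝟎 z≤n n)

  -- Junk value 0 if d diverges.
  value : ∀ {Γ} → Index → Env Γ → ℕ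
  value d φ with em {∃[ a ] d ⟦ φ ⟧≃ a}
  ... | yes (a , _) = a
  ... | no _        = 0

  value-unique : ∀ {Γ d a} {φ : Env Γ} → d ⟦ φ ⟧≃ a → value d φ ≡ a
  value-unique {d = d} {φ = φ} p with em {∃[ a ] d ⟦ φ ⟧≃ a}
  ... | yes (_ , q) = deterministic ext q p
  ... | no ¬q       = contradiction (_ , p) ¬q

  lam : ∀ τ → (Args (dom τ) → ℕ) → F τ
  lam 𝟎              h = h tt
  lam ((_ ∷ _) ⇒𝟎) h = h

  lam-· : ∀ τ h ξ → _·_ {τ} (lam τ h) ξ ≡ h ξ
  lam-· 𝟎              h ξ = refl
  lam-· ((_ ∷ _) ⇒𝟎) h ξ = refl

  values : ∀ {Γ} → List Index → Env Γ → ∀ τs → Args τs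
  values _        φ []       = tt
  -- Filler for a list `ds` that is too short; such an application never converges.
  values []       φ (τ ∷ τs) = lam τ (λ _ → 0) , values [] φ τs
  values (d ∷ ds) φ (τ ∷ τs) =
    lam τ (λ ξ → value d (++⁺ (totals (dom τ) ξ) φ)) , values ds φ τs

  base : ∀ {σ} → Entry σ → Args (dom σ) → Bases (dom σ)
  base (const _ _ cb) Gs = proj₁ (cb Gs)
  base hole           _  = fullBases (countable-dom-𝟏 ∷ [])

  record Config : Set₁ where
    constructor _∣_
    field
      {Γ}     : List Type
      index   : Index
      entries : Entries Γ

  Divergence : ∀ {Γ} → Index → Env Γ → Type → Set
  Divergence d φ τ = Σ[ ξ ∈ Args (dom τ) ] ¬ (∃[ a ] d ⟦ ++⁺ (totals (dom τ) ξ) φ ⟧≃ a)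

  divergence : ∀ {Γ} → Index → Env Γ → ∀ τ → Maybe (Args (dom τ))
  divergence d φ τ with em {Divergence d φ τ}
  ... | yes (ξ , _) = just ξ
  ... | no _        = nothing

  -- One point certifies totality: if any point diverged, the chosen one would, against the
  -- hypothesis. This keeps the examined points countable.
  no-divergence : ∀ {Γ d τ} {φ : Env Γ} →
    (∀ ξ → divergence d φ τ ≡ just ξ → ∃[ a ] d ⟦ ++⁺ (totals (dom τ) ξ) φ ⟧≃ a) →
    ∀ ξ → ∃[ a ] d ⟦ ++⁺ (totals (dom τ) ξ) φ ⟧≃ a
  no-divergence {d = d} {τ} {φ} H with em {Divergence d φ τ}
  ... | yes (ξ , ¬p) = contradiction (H ξ refl) ¬p
  ... | no ¬div      = λ ξ → decidable-stable em (λ ¬p → ¬div (ξ , ¬p))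

  points : ∀ {Γ} → Index → Env Γ → ∀ τ → CountableSubset (Args (dom τ)) → ℕ → Maybe (Args (dom τ))
  -- Number 0 is reserved for the divergent point, so the enumeration of the base is shifted by one.
  points d φ τ _           zero    = divergence d φ τ
  points d φ τ (_ , e , _) (suc n) = e n

  argument : ∀ {Γ τs} → All (RankAtMost 2) τs → Bases τs → List Index → Entries Γ →
    ℕ × ℕ → Maybe Config
  argument (h ∷ hs) (X ∷ Xs) (d ∷ ds) es (zero , n)  =
    map (λ ξ → d ∣ push h ξ es) (points d (env f₀ es) _ X n)
  argument (_ ∷ hs) (_ ∷ Xs) (_ ∷ ds) es (suc j , n) = argument hs Xs ds es (j , n)
  argument _        _        _        _  _           = nothing

  application : ∀ {Γ} → List Index → Entries Γ → Position Γ → ℕ × ℕ → Maybe Config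
  application ds es (σ , i) = argument (rank-dom σ (rank-entry e))
    (base e (values ds (env f₀ es) (dom σ))) ds es
    where e = All.lookup es i

  decode : ℕ → Maybe Index
  decode m with em {∃[ d ] ⌜ d ⌝ ≡ m}
  ... | yes (d , _) = just d
  ... | no _        = nothing

  decode-⌜⌝ : ∀ d → decode ⌜ d ⌝ ≡ just d
  decode-⌜⌝ d with em {∃[ d′ ] ⌜ d′ ⌝ ≡ ⌜ d ⌝}
  ... | yes (d′ , eq) = cong just (⌜⌝-injective d′ d eq)
  ... | no ¬p         = contradiction (d , refl) ¬p

  -- Branches are named by pairs: at an application, an argument position and the number of a point.
  -- Intermediate values are those for `f₀`, so the tree is the same for every `f` compared with it.
  sub : Config → ℕ × ℕ → Maybe Config
  sub (S4 d₁ d₂ ∣ es) (zero  , _) = just (d₂ ∣ es)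
  sub (S4 d₁ d₂ ∣ es) (suc _ , _) = just (d₁ ∣ (num (value d₂ (env f₀ es)) ∷ es))
  sub (S5 d₁ d₂ ∣ (const {𝟎} zero _ _ ∷ es)) _ = just (d₁ ∣ es)
  sub (S5 d₁ d₂ ∣ (const {𝟎} (suc n) _ _ ∷ es)) (zero , _) = just (S5 d₁ d₂ ∣ (num n ∷ es))
  sub (S5 d₁ d₂ ∣ (const {𝟎} (suc n) _ _ ∷ es)) (suc _ , _) =
    just (d₂ ∣ (num n ∷ num (value (S5 d₁ d₂) (env f₀ (num n ∷ es))) ∷ es))
  sub (S6 k d ∣ es) _ = locate _ k >>= λ (_ , i) → just (d ∣ (All.lookup es i ∷ ─⁺ i es))
  sub (S8 k ds ∣ es) b = locate _ k >>= λ σi → application ds es σi b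
  sub (S9 k ∣ (const {𝟎} m _ _ ∷ es)) _ = decode m >>= λ d → just (d ∣ take⁺ k es)
  sub _ _ = nothing

  queryOf : ∀ {σ} → Entry σ → Args (dom σ) → Maybe (Args (dom 𝟐))
  queryOf (const _ _ _) _  = nothing
  queryOf hole          Gs = just Gs

  query : Config → Maybe (Args (dom 𝟐))
  query (S8 k ds ∣ es) = locate _ k >>= λ (σ , i) →
    queryOf (All.lookup es i) (values ds (env f₀ es) (dom σ))
  query _ = nothing

  -- Recursion is on the path, so the support exists even when `c` diverges for `f₀`.
  support : List (ℕ × ℕ) → Config → Maybe (Args (dom 𝟐))
  support []      c = query c
  support (b ∷ p) c = sub c b >>= support p

  -- Transfer of computations from `f` to `f₀`

  module _ (f : F 𝟐) where

    Agrees : Config → Set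
    Agrees c = ∀ p y → support p c ≡ just y → f₀ y ≡ f y

    agrees-sub : ∀ {c c′} b → sub c b ≡ just c′ → Agrees c → Agrees c′
    agrees-sub {c} b eq H p y eq′ = H (b ∷ p) y (trans (cong (_>>= support p) eq) eq′)

    -- `sub` passes on the value for `f₀`; once this is known to be `a`, the subcomputation becomes
    -- the one actually carried out with `f`.
    agrees-value : ∀ {Γ} (c : ℕ → Config) {d a} {φ : Env Γ} → d ⟦ φ ⟧≃ a →
      Agrees (c (value d φ)) → Agrees (c a)
    agrees-value c p = subst (Agrees ∘ c) (value-unique p)

    AgreesOnArguments : ∀ {Γ τs} → All (RankAtMost 2) τs → Bases τs → List Index → Entries Γ → Set₁
    AgreesOnArguments hs Xs ds es = ∀ b c → argument hs Xs ds es b ≡ just c → Agrees c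

    -- Here `Gs` is the tuple for `f₀` and `Gs′` the one for `f`. For a constant, its base at `Gs`
    -- decides; at the hole the full base forces `Gs ≡ Gs′`, and this point is queried.
    fill-agree : ∀ {σs} (e : Entry (σs ⇒𝟎)) {Gs Gs′ : Args (toList σs)} →
      EqualOn (base e Gs) Gs Gs′ → (∀ y → queryOf e Gs ≡ just y → f₀ y ≡ f y) →
      fill f₀ e Gs ≡ fill f e Gs′
    fill-agree (const _ _ cb) eq _ = proj₂ (cb _) _ eq
    fill-agree hole {Gs} eq ask = trans (ask Gs refl)
      (cong f (equalOn-full ext (countable-dom-𝟏 ∷ []) eq))

    -- Induction on the computation with f.  An argument that diverges somewhere
    -- for f₀ diverges at a point of the support, where the induction hypothesis
    -- refutes it; hence convergence for f₀ need not be assumed.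
    mutual
      reflects : ∀ {Γ d a} {φ : Env Γ} → d ⟦ φ ⟧≃ a → (es : Entries Γ) → φ ≡ env f es →
        Agrees (d ∣ es) → d ⟦ env f₀ es ⟧≃ a
      reflects s1 (const _ _ _ ∷ es) refl H = s1
      reflects s2 es refl H = s2
      reflects s3 (const _ _ _ ∷ es) refl H = s3
      reflects (s4 {d₁ = d₁} p q) es refl H =
        s4 p′ (reflects q (num _ ∷ es) refl
          (agrees-value (λ b → d₁ ∣ (num b ∷ es)) p′ (agrees-sub (1 , 0) refl H)))
        where p′ = reflects p es refl (agrees-sub (0 , 0) refl H)
      reflects (s5₀ p) (const _ _ _ ∷ es) refl H =
        s5₀ (reflects p es refl (agrees-sub (0 , 0) refl H))
      reflects (s5₊ {d₂ = d₂} {n = n} p q) (const _ _ _ ∷ es) refl H =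
        s5₊ p′ (reflects q (num _ ∷ num _ ∷ es) refl
          (agrees-value (λ b → d₂ ∣ (num n ∷ num b ∷ es)) p′ (agrees-sub (1 , 0) refl H)))
        where p′ = reflects p (num n ∷ es) refl (agrees-sub (0 , 0) refl H)
      reflects (s6 {d = d} {a = a} i refl p) es refl H =
        s6 i refl (subst (λ φ → d ⟦ φ ⟧≃ a) (sym (env-select f₀))
          -- Moving an argument commutes with `env` only up to an equation, hence the hypothesis
          -- `φ ≡ env f es`.
          (reflects p (All.lookup es i ∷ ─⁺ i es) (env-select f)
            (agrees-sub (0 , 0) (cong (_>>= _) (locate-index i)) H)))
        where
        env-select : ∀ g → All.lookup (env g es) i ∷ ─⁺ i (env g es) ≡
                           env g (All.lookup es i ∷ ─⁺ i es)
        env-select g = cong₂ _∷_ (env-lookup g es i) (env-─ g es i)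
      reflects (s8 {σs = σs} {ds = ds} i refl Gs ps v) es refl H =
        -- The application is made at the tuple for `f₀`, which may differ from `Gs` off the bases.
        s8 i refl Gs₀ (proj₁ r) (trans (cong (λ g → g Gs₀) (env-lookup f₀ es i))
          (trans (cong just (fill-agree e (proj₂ r) asked))
            (trans (sym (cong (λ g → g Gs) (env-lookup f es i))) v)))
        where
        e   = All.lookup es i
        Gs₀ = values ds (env f₀ es) (toList σs)
        r   = reflects* ps (rank-dom (σs ⇒𝟎) (rank-entry e)) (base e Gs₀) es refl
          λ b c eq → agrees-sub b (trans (cong (_>>= _) (locate-index i)) eq) H
        asked : ∀ y → queryOf e Gs₀ ≡ just y → f₀ y ≡ f y
        asked y eq = H [] y (trans (cong (_>>= _) (locate-index i)) eq)
      reflects (s9 {k = k} {d = d} refl p) (const _ _ _ ∷ es) refl H =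
        s9 refl (subst (λ φ → d ⟦ φ ⟧≃ _) (sym (env-take f₀ k es))
          (reflects p (take⁺ k es) (env-take f k es)
            (agrees-sub (0 , 0) (cong (_>>= _) (decode-⌜⌝ d)) H)))

      reflects* : ∀ {Γ ds τs} {φ : Env Γ} {Gs : Args τs} → ds ⟦ φ ⟧≃* Gs →
        (hs : All (RankAtMost 2) τs) (Xs : Bases τs) (es : Entries Γ) → φ ≡ env f es →
        AgreesOnArguments hs Xs ds es →
        (ds ⟦ env f₀ es ⟧≃* values ds (env f₀ es) τs) × EqualOn Xs (values ds (env f₀ es) τs) Gs
      reflects* [] [] [] es refl H = [] , tt
      reflects* (_∷_ {σ = τ} {d = d} {ds = ds} {G = G} p ps) (h ∷ hs) (X ∷ Xs) es refl H =
        (converges ∷ proj₁ rest) , (equal , proj₂ rest)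
        where
        rest = reflects* ps hs Xs es refl λ (j , n) → H (suc j , n)
        at : ∀ n ξ → points d (env f₀ es) τ X n ≡ just ξ →
          d ⟦ ++⁺ (totals (dom τ) ξ) (env f₀ es) ⟧≃ _·_ {τ} G ξ
        at n ξ eq = subst (λ φ → d ⟦ φ ⟧≃ _) (env-push f₀ {τ = τ} h ξ es)
          (reflects (p ξ) (push {τ = τ} h ξ es) (sym (env-push f {τ = τ} h ξ es))
            (H (0 , n) _ (cong (map _) eq)))
        G₀ : F τ
        G₀ = lam τ (λ ξ → value d (++⁺ (totals (dom τ) ξ) (env f₀ es)))
        converges : ∀ ξ → d ⟦ ++⁺ (totals (dom τ) ξ) (env f₀ es) ⟧≃ _·_ {τ} G₀ ξ
        -- A point numbered 0 would diverge by choice and converge by `at`; so every point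
        -- converges.
        converges ξ with a , q ← no-divergence {τ = τ} (λ ξ eq → _ , at 0 ξ eq) ξ =
          subst (d ⟦ _ ⟧≃_) (sym (trans (lam-· τ _ ξ) (value-unique q))) q
        equal : ∀ ξ → proj₁ X ξ → _·_ {τ} G₀ ξ ≡ _·_ {τ} G ξ
        equal ξ x with n , eq ← proj₂ (proj₂ X) ξ x =
          deterministic ext (converges ξ) (at (suc n) ξ eq)

-- Diagonalising against a support

code : List (ℕ × ℕ) → List ℕ
code []            = []
code ((m , n) ∷ p) = m ∷ n ∷ code p

code-injective : ∀ p q → code p ≡ code q → p ≡ q
code-injective []      []      _  = refl
code-injective ((m , n) ∷ p) ((m′ , n′) ∷ q) eq
  with refl , eq′ ← ∷-injective eq
  with refl , eq″ ← ∷-injective eq′ = cong ((m , n) ∷_) (code-injective p q eq″)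

module _ (em : ExcludedMiddle 0ℓ) where

  -- Cantor's diagonal: the value at `suc k` defeats the point at the path coded by `k`. The value
  -- at 0 stays free for `b`, so two different functions can avoid the same support.
  avoid : (List (ℕ × ℕ) → Maybe (Args (dom 𝟐))) → ℕ → F 𝟏
  avoid s b (zero  , _) = b
  avoid s b (suc k , _) with em {∃[ p ] ∃[ y ] ⟪ code p ⟫ ≡ k × s p ≡ just y}
  ... | yes (_ , (y , _) , _) = suc (y (suc k , tt))
  ... | no _                  = 0

  avoid-≢ : ∀ s b p y → s p ≡ just (y , tt) → y ≢ avoid s b
  avoid-≢ s b p y eq y≡ = diagonal (cong (λ g → g (suc ⟪ code p ⟫ , tt)) y≡)
    where
    diagonal : y (suc ⟪ code p ⟫ , tt) ≢ avoid s b (suc ⟪ code p ⟫ , tt)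
    diagonal with em {∃[ q ] ∃[ z ] ⟪ code q ⟫ ≡ ⟪ code p ⟫ × s q ≡ just z}
    ... | no ¬q = λ _ → ¬q (p , (y , tt) , refl , eq)
    ... | yes (q , (z , _) , eq₁ , eq₂)
      -- The path found by excluded middle is `p` itself, as the coding is injective.
      with refl ← code-injective q p (⟪⟫-injective (code q) (code p) eq₁)
      with refl ← trans (sym eq) eq₂ = λ e → 1+n≢n (sym e)

  -- Singletons and the values of `Ω₁` on them

  singleton : F 𝟏 → F 𝟐
  singleton x (y , _) with em {y ≡ x}
  ... | yes _ = 1
  ... | no  _ = 0

  singleton-characteristic : ∀ x → singleton x IsCharacteristicFunctionOf (_≡ x)
  singleton-characteristic x y with em {y ≡ x}
  ... | yes eq = (λ _ → refl) , λ ¬eq → contradiction eq ¬eq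
  ... | no ¬eq = (λ eq → contradiction eq ¬eq) , λ _ → refl

  Ω₁-singleton : ∀ x n → Ω₁ em (singleton x , n , tt) ≡ just (x (n , tt))
  Ω₁-singleton x n with em {∃[ x′ ] singleton x IsCharacteristicFunctionOf (_≡ x′)}
  ... | no ¬c = contradiction (x , singleton-characteristic x) ¬c
  -- If `x′` were not `x`, then `singleton x` would take both values 1 and 0 at `x`.
  ... | yes (x′ , c) = cong (λ g → just (g (n , tt))) (decidable-stable em λ x′≢x →
    contradiction (trans (sym (proj₁ (singleton-characteristic x x) refl))
      (proj₂ (c x) (x′≢x ∘ sym))) λ ())

theorem3p28 : (em : ExcludedMiddle 0ℓ) → Extensionality 0ℓ 0ℓ →
    ∀ σ → rank σ ≡ 3 → (Φ : F σ) → CountablyBased σ Φ →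
    ¬ Computable τΩ₁ (Ω₁ em) (total {σ} Φ ∷ [])
theorem3p28 em ext σ rank≡3 Φ cb (e , computes) =
  contradiction (deterministic ext (value-at-∅ 0) (value-at-∅ 1)) λ ()
  where
  ∅ : F 𝟐
  ∅ _ = 0
  open Support em ext ∅

  es : Entries (𝟐 ∷ 𝟎 ∷ σ ∷ [])
  -- The number argument of `Ω₁` is fixed at 0, where `avoid` takes the prescribed value `b`.
  es = hole ∷ num 0 ∷ const Φ (≤-reflexive rank≡3) cb ∷ []

  computation : ∀ x → ｛ e ｝ env (singleton em x) es ≃ x (0 , tt)
  computation x = computes (singleton em x , 0 , tt) _ (Ω₁-singleton em x 0)

  d : Index
  -- Each computation brings its own index with number `e`; by injectivity they coincide, so any
  -- instance serves.
  d = proj₁ (computation λ _ → 0)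

  x : ℕ → F 𝟏
  x = avoid em (λ p → support p (d ∣ es))

  d-computes : ∀ b → d ⟦ env (singleton em (x b)) es ⟧≃ b
  d-computes b with d′ , eq , p ← computation (x b) =
    subst (_⟦ _ ⟧≃ _) (⌜⌝-injective d′ d (trans eq (sym (proj₁ (proj₂ (computation λ _ → 0)))))) p

  value-at-∅ : ∀ b → d ⟦ env ∅ es ⟧≃ b
  -- Support points differ from `x b`, so its singleton vanishes on them, as `∅` does.
  value-at-∅ b = reflects (singleton em (x b)) (d-computes b) es refl λ p (y , _) eq →
    sym (proj₂ (singleton-characteristic em (x b) y) (avoid-≢ em _ b p y eq))
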